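{- Local tabularity of a product logic does not imply the product finite model property: there exist logics $L_1$, $L_2$ (over disjoint finite alphabets) such that $L_1\times L_2$ is locally tabular but $L_1\times L_2$ does not have the product finite model property.
   Context: For an $\mathrm{A}$-frame $F$ and a $\mathrm{B}$-frame $G$ ($\mathrm{A},\mathrm{B}$ disjoint finite sets of diamonds) on sets $X,Y$, the product $F\times G$ is the frame on $X\times Y$ in which each $\lozenge\in\mathrm{A}$ acts via $(a,b)R^h_\lozenge(a',b)$ iff $aR_\lozenge a'$ and each $\lozenge\in\mathrm{B}$ via $(a,b)R^v_\lozenge(a,b')$ iff $bS_\lozenge b'$. For logics $L_1$ (an $\mathrm{A}$-logic) and $L_2$ (a $\mathrm{B}$-logic), $L_1\times L_2$ is the set of formulas valid in all $F\times G$ with $F\models L_1$ and $G\models L_2$. A logic is locally tabular if for every finite $k$ it has only finitely many pairwise nonequivalent formulas in $k$ variables. A logic $L$ has the product finite model property if $L$ is the set of formulas valid in some class of product frames $F\times G$ with $F,G$ finite. -}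

module Defs where

open import Level using (Level; 0ℓ) renaming (suc to lsuc)
open import Data.Nat using (ℕ; _<_)
open import Data.Fin using (Fin)
open import Data.Bool using (Bool; true; false; not; _∨_)
open import Data.Sum using (_⊎_; inj₁; inj₂)
open import Data.Product using (Σ; ∃; _×_; _,_)
open import Data.Empty using (⊥)
open import Relation.Nullary using (¬_)
open import Relation.Unary using (Pred)
open import Relation.Binary.PropositionalEquality using (_≡_)
open import Function.Bundles using (_↔_; _⇔_)

data Form (D : Set) : Set where
  var  : ℕ → Form D
  ⊥'   : Form D
  _⇒_  : Form D → Form D → Form D
  ◇    : D → Form D → Form D

infixr 5 _⇒_

module _ {D : Set} where
  ¬' : Form D → Form D
  ¬' φ = φ ⇒ ⊥'

  □ : D → Form D → Form D
  □ d φ = ¬' (◇ d (¬' φ))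

  _∧'_ : Form D → Form D → Form D
  φ ∧' ψ = ¬' (φ ⇒ ¬' ψ)

  _⇔'_ : Form D → Form D → Form D
  φ ⇔' ψ = (φ ⇒ ψ) ∧' (ψ ⇒ φ)

  sub : (ℕ → Form D) → Form D → Form D
  sub σ (var p)   = σ p
  sub σ ⊥'        = ⊥'
  sub σ (φ ⇒ ψ)   = sub σ φ ⇒ sub σ ψ
  sub σ (◇ d φ)   = ◇ d (sub σ φ)

  InVars : ℕ → Form D → Set
  InVars k (var p)  = p < k
  InVars k ⊥'       = Data.Unit.⊤ where import Data.Unit
  InVars k (φ ⇒ ψ)  = InVars k φ × InVars k ψ
  InVars k (◇ d φ)  = InVars k φ

  evalB : (Form D → Bool) → Form D → Bool
  evalB v (var p)  = v (var p)
  evalB v ⊥'       = false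
  evalB v (φ ⇒ ψ)  = not (evalB v φ) ∨ evalB v ψ
  evalB v (◇ d φ)  = v (◇ d φ)

  Tautology : Form D → Set
  Tautology φ = ∀ (v : Form D → Bool) → evalB v φ ≡ true

record NormalLogic {D : Set} (L : Pred (Form D) (lsuc 0ℓ)) : Set₁ where
  field
    taut : ∀ φ → Tautology φ → L φ
    axK  : ∀ d φ ψ → L (□ d (φ ⇒ ψ) ⇒ (□ d φ ⇒ □ d ψ))
    mp   : ∀ φ ψ → L φ → L (φ ⇒ ψ) → L ψ
    nec  : ∀ d φ → L φ → L (□ d φ)
    subst : ∀ σ φ → L φ → L (sub σ φ)

record Frame (D : Set) : Set₁ where
  field
    W : Set
    R : D → W → W → Set
open Frame public

-- Truth is interpreted classically via double negation, so that every
-- classical tautology is valid in every frame (constructive metatheory).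
Sat : {D : Set} (F : Frame D) → (ℕ → W F → Set) → W F → Form D → Set
Sat F V w (var p)  = ¬ ¬ V p w
Sat F V w ⊥'       = ⊥
Sat F V w (φ ⇒ ψ)  = Sat F V w φ → Sat F V w ψ
Sat F V w (◇ d φ)  = ¬ ¬ (Σ (W F) λ w' → R F d w w' × Sat F V w' φ)

Valid : {D : Set} → Frame D → Form D → Set₁
Valid F φ = ∀ (V : ℕ → W F → Set) (w : W F) → Sat F V w φ

_⊨_ : {D : Set} → Frame D → Pred (Form D) (lsuc 0ℓ) → Set₁
F ⊨ L = ∀ φ → L φ → Valid F φ

Finite : Set → Set
Finite X = Σ ℕ λ n → X ↔ Fin n

_⊗_ : {A B : Set} → Frame A → Frame B → Frame (A ⊎ B)
W (F ⊗ G) = W F × W G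
R (F ⊗ G) (inj₁ a) (x , y) (x' , y') = R F a x x' × y ≡ y'
R (F ⊗ G) (inj₂ b) (x , y) (x' , y') = x ≡ x' × R G b y y'

_×L_ : {A B : Set} → Pred (Form A) (lsuc 0ℓ) → Pred (Form B) (lsuc 0ℓ)
     → Pred (Form (A ⊎ B)) (lsuc 0ℓ)
(L₁ ×L L₂) φ = ∀ (F : Frame _) (G : Frame _) → F ⊨ L₁ → G ⊨ L₂ → Valid (F ⊗ G) φ

LocallyTabular : {D : Set} → Pred (Form D) (lsuc 0ℓ) → Set₁
LocallyTabular {D} L =
  ∀ (k : ℕ) → Σ ℕ λ N → Σ (Fin N → Form D) λ rep →
    ∀ φ → InVars k φ → Σ (Fin N) λ i → L (φ ⇔' rep i)

ProductFMP : {A B : Set} → Pred (Form (A ⊎ B)) (lsuc 0ℓ) → Set₂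
ProductFMP {A} {B} L =
  Σ (Frame A → Frame B → Set₁) λ 𝒞 →
    (∀ F G → 𝒞 F G → Finite (W F) × Finite (W G)) ×
    (∀ φ → L φ ⇔ (∀ F G → 𝒞 F G → Valid (F ⊗ G) φ))

{-# OPTIONS --safe #-}

-- Both factors have bounded height: F∞ is a root with infinitely many leaves,
-- and G∞ has a root seeing points mid n, where mid n sees leaf m iff n ≤ m.
-- Hence every point of a product of an L₁-frame and an L₂-frame starts only
-- paths of fewer than four steps, and over such points each formula in k
-- variables is a Boolean combination of a fixed finite list of formulas.
--
-- The logic of G∞ contains ◇□p ∧ ◇□q → ◇□(p ∧ q): any two successors u, v of
-- a point have a common "refinement" t, a successor whose own successors are
-- seen by both u and v.  In a product, the negation of `¬escape` says at (r , g)
-- that g has successors, that all of them have successors, and that for every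
-- y two steps above g some successor of g does not see y.  If G is finite,
-- iterated refinement gives a successor of g that sees nothing, a
-- contradiction; in F∞ ⊗ G∞ the formula is satisfiable.

module Submission where

open import Defs
open import Data.Bool using (Bool; false; if_then_else_)
open import Data.Empty using (⊥; ⊥-elim)
open import Data.Fin using (Fin; zero; suc)
open import Data.List using (List; []; _∷_; [_]; _++_; map; length; lookup; upTo; cartesianProductWith)
open import Data.List.Membership.Propositional using (_∈_)
open import Data.List.Membership.Propositional.Properties using (∈-++⁺ˡ; ∈-++⁺ʳ; ∈-map⁺; ∈-upTo⁺; ∈-cartesianProductWith⁺)
open import Data.List.Relation.Unary.All using (All; []; _∷_)
open import Data.List.Relation.Unary.Any using (here; there; index)
open import Data.List.Relation.Unary.Any.Properties using (lookup-index)
open import Data.Maybe using (Maybe; just; nothing)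
open import Data.Nat using (ℕ; zero; suc; _+_; _≤_; _<_; _⊔_)
open import Data.Nat.Properties using (≤-refl; ≤-trans; <⇒≱; m≤m⊔n; m≤n⊔m; +-suc)
open import Data.Product using (Σ; _×_; _,_; proj₁; proj₂)
open import Data.Sum using (_⊎_; inj₁; inj₂)
open import Data.Unit using (⊤)
open import Function using (id; _∘_)
open import Function.Bundles using (_⇔_; mk⇔; module Equivalence; module Inverse)
open import Function.Properties.Equivalence using (⇔-isEquivalence)
open import Level using (0ℓ) renaming (suc to lsuc)
open import Relation.Binary using (DecidableEquality; IsEquivalence)
open import Relation.Binary.PropositionalEquality using (refl; sym; subst)
open import Relation.Nullary using (¬_; Dec; yes; no; does; proof; Reflects; ofⁿ; invert; ¬¬-excluded-middle)
open import Relation.Nullary.Reflects using (_→-reflects_)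
open import Relation.Unary using (Pred)
import Data.Fin.Properties as Fin
import Data.Nat.Properties as ℕ

open Equivalence using (to; from)
open module ⇔ {ℓ} = IsEquivalence (⇔-isEquivalence {ℓ}) using () renaming (refl to ⇔-refl; sym to ⇔-sym; trans to ⇔-trans)

⊤' : {D : Set} → Form D
⊤' = ¬' ⊥'

-- Semantics

Sat-stable : {D : Set} (F : Frame D) {V : ℕ → W F → Set} {w : W F} (φ : Form D) →
  ¬ ¬ Sat F V w φ → Sat F V w φ
Sat-stable F (var p) s = λ k → s (λ t → t k)
Sat-stable F ⊥' s = s id
Sat-stable F (φ ⇒ ψ) s = λ a → Sat-stable F ψ (λ k → s (λ f → k (f a)))
Sat-stable F (◇ d φ) s = λ k → s (λ t → t k)

-- Satisfaction is stable under double negation, so any proposition may be decided while proving it;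
-- classical case splits enter here.
Sat-cases : {D : Set} (F : Frame D) {V : ℕ → W F → Set} {w : W F} (φ : Form D) {A : Set} →
  (Dec A → Sat F V w φ) → Sat F V w φ
Sat-cases F φ f = Sat-stable F φ λ k → ¬¬-excluded-middle (k ∘ f)

module _ {D : Set} (F : Frame D) (V : ℕ → W F → Set) (w : W F) where

  □-intro : ∀ d φ → (∀ w' → R F d w w' → Sat F V w' φ) → Sat F V w (□ d φ)
  □-intro d φ f s = s λ (w' , r , n) → n (f w' r)

  □-elim : ∀ d φ → Sat F V w (□ d φ) → ∀ w' → R F d w w' → Sat F V w' φ
  □-elim d φ s w' r = Sat-stable F φ λ n → s λ k → k (w' , r , n)

  ∧-intro : ∀ φ ψ → Sat F V w φ → Sat F V w ψ → Sat F V w (φ ∧' ψ)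
  ∧-intro φ ψ a b f = f a b

  ∧-elim : ∀ φ ψ → Sat F V w (φ ∧' ψ) → Sat F V w φ × Sat F V w ψ
  ∧-elim φ ψ s = Sat-stable F φ (λ n → s λ a _ → n a) , Sat-stable F ψ (λ n → s λ _ b → n b)

◇-cong : {D : Set} (F : Frame D) {V V' : ℕ → W F → Set} {w : W F} {d : D} {φ ψ : Form D} →
  (∀ w' → R F d w w' → Sat F V w' φ ⇔ Sat F V' w' ψ) → Sat F V w (◇ d φ) ⇔ Sat F V' w (◇ d ψ)
◇-cong F e = mk⇔
  (λ s k → s λ (w' , r , t) → k (w' , r , to (e w' r) t))
  (λ s k → s λ (w' , r , t) → k (w' , r , from (e w' r) t))

→-cong : {A A' B B' : Set} → A ⇔ A' → B ⇔ B' → (A → B) ⇔ (A' → B')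
→-cong e e' = mk⇔ (λ f → to e' ∘ f ∘ from e) (λ f → from e' ∘ f ∘ to e)

Sat-sub : {D : Set} (F : Frame D) {V : ℕ → W F → Set} (σ : ℕ → Form D) (w : W F) (φ : Form D) →
  Sat F V w (sub σ φ) ⇔ Sat F (λ p u → Sat F V u (σ p)) w φ
Sat-sub F σ w (var p) = mk⇔ (λ s k → k s) (Sat-stable F (σ p))
Sat-sub F σ w ⊥' = ⇔-refl
Sat-sub F σ w (φ ⇒ ψ) = →-cong (Sat-sub F σ w φ) (Sat-sub F σ w ψ)
Sat-sub F σ w (◇ d φ) = ◇-cong F {φ = sub σ φ} {ψ = φ} λ w' _ → Sat-sub F σ w' φ

-- The logic of a frame

module _ {D : Set} (_≟D_ : DecidableEquality D) where

  _≟_ : DecidableEquality (Form D)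
  var p ≟ var q with p ℕ.≟ q
  ... | yes refl = yes refl
  ... | no p≢q = no λ { refl → p≢q refl }
  ⊥' ≟ ⊥' = yes refl
  (φ ⇒ ψ) ≟ (φ' ⇒ ψ') with φ ≟ φ' | ψ ≟ ψ'
  ... | yes refl | yes refl = yes refl
  ... | no φ≢φ' | _ = no λ { refl → φ≢φ' refl }
  ... | _ | no ψ≢ψ' = no λ { refl → ψ≢ψ' refl }
  ◇ d φ ≟ ◇ d' φ' with d ≟D d' | φ ≟ φ'
  ... | yes refl | yes refl = yes refl
  ... | no d≢d' | _ = no λ { refl → d≢d' refl }
  ... | _ | no φ≢φ' = no λ { refl → φ≢φ' refl }
  var _ ≟ ⊥' = no λ ()
  var _ ≟ (_ ⇒ _) = no λ ()
  var _ ≟ ◇ _ _ = no λ ()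
  ⊥' ≟ var _ = no λ ()
  ⊥' ≟ (_ ⇒ _) = no λ ()
  ⊥' ≟ ◇ _ _ = no λ ()
  (_ ⇒ _) ≟ var _ = no λ ()
  (_ ⇒ _) ≟ ⊥' = no λ ()
  (_ ⇒ _) ≟ ◇ _ _ = no λ ()
  ◇ _ _ ≟ var _ = no λ ()
  ◇ _ _ ≟ ⊥' = no λ ()
  ◇ _ _ ≟ (_ ⇒ _) = no λ ()

  propAtoms : Form D → List (Form D)
  propAtoms (var p) = [ var p ]
  propAtoms ⊥' = []
  propAtoms (φ ⇒ ψ) = propAtoms φ ++ propAtoms ψ
  propAtoms (◇ d φ) = [ ◇ d φ ]

  ¬¬-decideAll : (P : Form D → Set) (αs : List (Form D)) → ¬ ¬ All (Dec ∘ P) αs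
  ¬¬-decideAll P [] k = k []
  ¬¬-decideAll P (α ∷ αs) k = ¬¬-decideAll P αs λ ds → ¬¬-excluded-middle λ d → k (d ∷ ds)

  assignment : {P : Form D → Set} {αs : List (Form D)} → All (Dec ∘ P) αs → Form D → Bool
  assignment [] β = false
  assignment {αs = α ∷ _} (d ∷ ds) β = if does (β ≟ α) then does d else assignment ds β

  assignment-reflects : {P : Form D → Set} {αs : List (Form D)} (ds : All (Dec ∘ P) αs) →
    ∀ {β} → β ∈ αs → Reflects (P β) (assignment ds β)
  assignment-reflects {αs = α ∷ _} (d ∷ ds) {β} β∈ with β ≟ α
  assignment-reflects (d ∷ ds) β∈         | yes refl = proof d
  assignment-reflects (d ∷ ds) (here β≡α) | no β≢α = ⊥-elim (β≢α β≡α)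
  assignment-reflects (d ∷ ds) (there β∈) | no _ = assignment-reflects ds β∈

  evalB-reflects : (F : Frame D) {V : ℕ → W F → Set} {w : W F} (v : Form D → Bool) (φ : Form D) →
    (∀ {β} → β ∈ propAtoms φ → Reflects (Sat F V w β) (v β)) →
    Reflects (Sat F V w φ) (evalB v φ)
  evalB-reflects F v (var p) h = h (here refl)
  evalB-reflects F v ⊥' h = ofⁿ id
  evalB-reflects F v (φ ⇒ ψ) h =
    evalB-reflects F v φ (h ∘ ∈-++⁺ˡ) →-reflects evalB-reflects F v ψ (h ∘ ∈-++⁺ʳ (propAtoms φ))
  evalB-reflects F v (◇ d φ) h = h (here refl)

  -- `evalB` consults its valuation only at the finitely many propositional atoms of `φ`. Their
  -- truth at `w` is decidable under a double negation, which the stability of `φ` removes.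
  tautology-valid : (F : Frame D) (φ : Form D) → Tautology φ → Valid F φ
  tautology-valid F φ t V w = Sat-stable F φ λ k →
    ¬¬-decideAll (Sat F V w) (propAtoms φ) λ ds →
      k (invert (subst (Reflects _) (t (assignment ds))
          (evalB-reflects F (assignment ds) φ (assignment-reflects ds))))

  Valid-normal : (F : Frame D) → NormalLogic (Valid F)
  Valid-normal F = record
    { taut = tautology-valid F
    ; axK = λ d φ ψ V w i b → □-intro F V w d ψ λ w' r → □-elim F V w d (φ ⇒ ψ) i w' r (□-elim F V w d φ b w' r)
    ; mp = λ φ ψ a i V w → i V w (a V w)
    ; nec = λ d φ a V w → □-intro F V w d φ λ w' _ → a V w'
    ; subst = λ σ φ a V w → from (Sat-sub F σ w φ) (a _ w)
    }

-- Bounded height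

-- A strict bound on the number of steps: `0` holds nowhere and `1` holds exactly at dead ends.
NoPath : {D : Set} (F : Frame D) → ℕ → W F → Set
NoPath F zero w = ⊥
NoPath F (suc h) w = ∀ d w' → R F d w w' → NoPath F h w'

-- A step in the product moves exactly one coordinate, so the bounds `a` and `b` on the number of
-- steps in the factors add up.
NoPath-⊗ : {A B : Set} (F : Frame A) (G : Frame B) (a b : ℕ) {x : W F} {y : W G} →
  NoPath F (suc a) x → NoPath G (suc b) y → NoPath (F ⊗ G) (suc (a + b)) (x , y)
NoPath-⊗ F G zero b p q (inj₁ d) _ (r , refl) = ⊥-elim (p d _ r)
NoPath-⊗ F G (suc a) b p q (inj₁ d) _ (r , refl) = NoPath-⊗ F G a b (p d _ r) q
NoPath-⊗ F G a zero p q (inj₂ d) _ (refl , r) = ⊥-elim (q d _ r)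
NoPath-⊗ F G a (suc b) p q (inj₂ d) _ (refl , r)
  rewrite +-suc a b = NoPath-⊗ F G a b p (q d _ r)

path : ℕ → Form (Fin 1)
path zero = ⊤'
path (suc h) = ◇ zero (path h)

¬path⇒NoPath : (F : Frame (Fin 1)) {V : ℕ → W F → Set} (h : ℕ) {w : W F} →
  ¬ Sat F V w (path h) → NoPath F h w
¬path⇒NoPath F zero n = n id
¬path⇒NoPath F (suc h) n zero w' r = ¬path⇒NoPath F h λ s → n λ k → k (w' , r , s)

NoPath⇒¬path : (F : Frame (Fin 1)) {V : ℕ → W F → Set} (h : ℕ) {w : W F} →
  NoPath F h w → ¬ Sat F V w (path h)
NoPath⇒¬path F zero n _ = n
NoPath⇒¬path F (suc h) n s = s λ (w' , r , t) → NoPath⇒¬path F h (n zero w' r) t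

-- The bound is expressed by the formula `¬' (path h)`, so it passes from `F₀` to every frame of its
-- logic.
⊨Valid⇒NoPath : (F₀ F : Frame (Fin 1)) (h : ℕ) → (∀ w → NoPath F₀ h w) →
  F ⊨ Valid F₀ → ∀ w → NoPath F h w
⊨Valid⇒NoPath F₀ F h n F⊨ w =
  ¬path⇒NoPath F h (F⊨ (¬' (path h)) (λ V u → NoPath⇒¬path F₀ h (n u)) (λ _ _ → ⊤) w)

-- Finitely many formulas at bounded height

module _ {D : Set} where

  ite : Form D → Form D → Form D → Form D
  ite α χ ξ = (α ⇒ χ) ∧' (¬' α ⇒ ξ)

  Equiv : ℕ → Form D → Form D → Set₁
  Equiv h φ ψ = ∀ F V w → NoPath F h w → Sat F V w φ ⇔ Sat F V w ψ

  module _ (F : Frame D) {V : ℕ → W F → Set} {w : W F} (α χ ξ : Form D) where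

    ite-true : Sat F V w α → Sat F V w (ite α χ ξ) ⇔ Sat F V w χ
    ite-true a = mk⇔
      (λ s → proj₁ (∧-elim F V w (α ⇒ χ) (¬' α ⇒ ξ) s) a)
      (λ s → ∧-intro F V w (α ⇒ χ) (¬' α ⇒ ξ) (λ _ → s) (λ n → Sat-stable F ξ λ _ → n a))

    ite-false : ¬ Sat F V w α → Sat F V w (ite α χ ξ) ⇔ Sat F V w ξ
    ite-false n = mk⇔
      (λ s → proj₂ (∧-elim F V w (α ⇒ χ) (¬' α ⇒ ξ) s) n)
      (λ s → ∧-intro F V w (α ⇒ χ) (¬' α ⇒ ξ) (λ a → Sat-stable F χ λ _ → n a) (λ _ → s))

  Sat-cases-⇔ : (F : Frame D) {V : ℕ → W F → Set} {w : W F} (φ ψ : Form D) {A : Set} →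
    (A → Sat F V w φ ⇔ Sat F V w ψ) → (¬ A → Sat F V w φ ⇔ Sat F V w ψ) →
    Sat F V w φ ⇔ Sat F V w ψ
  Sat-cases-⇔ F φ ψ {A} f g = mk⇔
    (λ s → Sat-cases F ψ λ d → to (h d) s) (λ s → Sat-cases F φ λ d → from (h d) s)
    where
    h : Dec A → _
    h (yes a) = f a
    h (no n) = g n

  ite-Equiv : ∀ {h} α {χ ξ} φ →
    (∀ F V w → NoPath F h w → Sat F V w α → Sat F V w χ ⇔ Sat F V w φ) →
    (∀ F V w → NoPath F h w → ¬ Sat F V w α → Sat F V w ξ ⇔ Sat F V w φ) →
    Equiv h (ite α χ ξ) φ
  ite-Equiv α {χ} {ξ} φ f g F V w n = Sat-cases-⇔ F (ite α χ ξ) φ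
    (λ a → ⇔-trans (ite-true F α χ ξ a) (f F V w n a))
    (λ b → ⇔-trans (ite-false F α χ ξ b) (g F V w n b))

  -- Combo αs φ: φ is a complete Shannon expansion over αs.
  data Combo : List (Form D) → Form D → Set where
    bot : Combo [] ⊥'
    top : Combo [] ⊤'
    node : ∀ {α αs χ ξ} → Combo αs χ → Combo αs ξ → Combo (α ∷ αs) (ite α χ ξ)

  combos : List (Form D) → List (Form D)
  combos [] = ⊥' ∷ ⊤' ∷ []
  combos (α ∷ αs) = cartesianProductWith (ite α) (combos αs) (combos αs)

  Combo⇒∈ : ∀ {αs φ} → Combo αs φ → φ ∈ combos αs
  Combo⇒∈ bot = here refl
  Combo⇒∈ top = there (here refl)
  Combo⇒∈ (node {α} c d) = ∈-cartesianProductWith⁺ (ite α) (Combo⇒∈ c) (Combo⇒∈ d)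

  Rep : ℕ → List (Form D) → Form D → Set₁
  Rep h αs φ = Σ (Form D) λ θ → Combo αs θ × Equiv h θ φ

  Rep-⊥ : ∀ {h} αs → Rep h αs ⊥'
  Rep-⊥ [] = ⊥' , bot , λ _ _ _ _ → ⇔-refl
  Rep-⊥ (α ∷ αs) with θ , c , e ← Rep-⊥ αs =
    _ , node c c , ite-Equiv α ⊥' (λ F V w n _ → e F V w n) (λ F V w n _ → e F V w n)

  Rep-⊤ : ∀ {h} αs → Rep h αs ⊤'
  Rep-⊤ [] = ⊤' , top , λ _ _ _ _ → ⇔-refl
  Rep-⊤ (α ∷ αs) with θ , c , e ← Rep-⊤ αs =
    _ , node c c , ite-Equiv α ⊤' (λ F V w n _ → e F V w n) (λ F V w n _ → e F V w n)

  Rep-∈ : ∀ {h αs β} → β ∈ αs → Rep h αs β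
  Rep-∈ {αs = α ∷ αs} (here refl)
    with t , ct , et ← Rep-⊤ αs | b , cb , eb ← Rep-⊥ αs =
    -- Branching on `α` itself leaves `⊤'` where it holds and `⊥'` where it fails.
    _ , node ct cb , ite-Equiv α α
      (λ F V w n a → mk⇔ (λ _ → a) (λ _ → from (et F V w n) id))
      (λ F V w n na → mk⇔ (λ s → ⊥-elim (to (eb F V w n) s)) (λ a → ⊥-elim (na a)))
  Rep-∈ {αs = α ∷ αs} {β} (there β∈) with θ , c , e ← Rep-∈ β∈ =
    _ , node c c , ite-Equiv α β (λ F V w n _ → e F V w n) (λ F V w n _ → e F V w n)

  -- Both expansions branch on the same formulas in the same order, so the implication is computed
  -- branch by branch, down to the constants.
  Combo-⇒ : ∀ {h αs χ ξ} → Combo αs χ → Combo αs ξ → Rep h αs (χ ⇒ ξ)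
  Combo-⇒ bot _ = ⊤' , top , λ F V w n → mk⇔ (λ _ → ⊥-elim) (λ _ → id)
  Combo-⇒ top top = ⊤' , top , λ F V w n → mk⇔ (λ _ _ → id) (λ _ → id)
  Combo-⇒ top bot = ⊥' , bot , λ F V w n → mk⇔ ⊥-elim (λ f → f id)
  Combo-⇒ {αs = α ∷ _} (node {χ = χ₁} {χ₂} c₁ c₂) (node {χ = ξ₁} {ξ₂} d₁ d₂)
    with _ , k₁ , e₁ ← Combo-⇒ c₁ d₁ | _ , k₂ , e₂ ← Combo-⇒ c₂ d₂ =
    _ , node k₁ k₂ , ite-Equiv α (ite α χ₁ χ₂ ⇒ ite α ξ₁ ξ₂)
      (λ F V w n a → ⇔-trans (e₁ F V w n)
        (⇔-sym (→-cong (ite-true F α χ₁ χ₂ a) (ite-true F α ξ₁ ξ₂ a))))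
      (λ F V w n a → ⇔-trans (e₂ F V w n)
        (⇔-sym (→-cong (ite-false F α χ₁ χ₂ a) (ite-false F α ξ₁ ξ₂ a))))

  Rep-⇒ : ∀ {h αs φ ψ} → Rep h αs φ → Rep h αs ψ → Rep h αs (φ ⇒ ψ)
  Rep-⇒ (_ , c , e) (_ , d , e') with θ , k , e'' ← Combo-⇒ c d =
    θ , k , λ F V w n → ⇔-trans (e'' F V w n) (→-cong (e F V w n) (e' F V w n))

  module _ {ds : List D} (ds-complete : ∀ d → d ∈ ds) (k : ℕ) where

    atoms : List (Form D) → List (Form D)
    atoms θs = map var (upTo k) ++ cartesianProductWith ◇ ds θs

    reps : ℕ → List (Form D)
    reps zero = [ ⊥' ]
    reps (suc h) = combos (atoms (reps h))

    -- Induction on `h`, mutual with `Rep-atoms`. Successors of a point with bound `suc h` have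
    -- bound `h`, so the argument of a diamond can be replaced by its representative for `h`. Every
    -- formula thus becomes a Boolean combination of `atoms (reps h)`.
    reps-complete : ∀ h φ → InVars k φ → Σ (Form D) λ θ → θ ∈ reps h × Equiv h θ φ

    Rep-atoms : ∀ h φ → InVars k φ → Rep (suc h) (atoms (reps h)) φ
    Rep-atoms h (var p) p<k = Rep-∈ (∈-++⁺ˡ (∈-map⁺ var (∈-upTo⁺ p<k)))
    Rep-atoms h ⊥' _ = Rep-⊥ (atoms (reps h))
    Rep-atoms h (φ ⇒ ψ) (i , j) = Rep-⇒ (Rep-atoms h φ i) (Rep-atoms h ψ j)
    Rep-atoms h (◇ d φ) i
      with θ , θ∈ , e ← reps-complete h φ i
      with θ' , c , e' ← Rep-∈ {suc h} (∈-++⁺ʳ (map var (upTo k)) (∈-cartesianProductWith⁺ ◇ (ds-complete d) θ∈)) =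
      θ' , c , λ F V w n → ⇔-trans (e' F V w n)
        (◇-cong F {φ = θ} {ψ = φ} λ w' r → e F V w' (n d w' r))

    -- No point has bound `0`, so `⊥'` represents every formula.
    reps-complete zero φ _ = ⊥' , here refl , λ F V w ()
    reps-complete (suc h) φ i with θ , c , e ← Rep-atoms h φ i = θ , Combo⇒∈ c , e

  NoPath⇒LocallyTabular : {ds : List D} → (∀ d → d ∈ ds) → (h : ℕ) (L : Pred (Form D) (lsuc 0ℓ)) →
    (∀ φ → (∀ F V w → NoPath F h w → Sat F V w φ) → L φ) → LocallyTabular L
  NoPath⇒LocallyTabular dc h L complete k =
    length (reps dc k h) , lookup (reps dc k h) , λ φ i →
      let θ , θ∈ , e = reps-complete dc k h φ i in
      index θ∈ , subst (λ ρ → L (φ ⇔' ρ)) (lookup-index θ∈)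
        (complete (φ ⇔' θ) λ F V w n →
          ∧-intro F V w (φ ⇒ θ) (θ ⇒ φ) (from (e F V w n)) (to (e F V w n)))

-- Directedness

module _ {D : Set} (d : D) where

  directed : Form D
  directed = ◇ d (□ d (var 0)) ⇒ ◇ d (□ d (var 1)) ⇒ ◇ d (□ d (var 0 ∧' var 1))

  -- The first-order correspondent of `directed`; its double negations match those in `Sat`.
  Directed : Frame D → Set
  Directed F = ∀ w u v → R F d w u → R F d w v →
    ¬ ¬ Σ (W F) λ t → R F d w t × ∀ s → R F d t s → ¬ ¬ (R F d u s × R F d v s)

  Directed⇒valid : (F : Frame D) → Directed F → Valid F directed
  Directed⇒valid F dir V w s₀ s₁ k =
    s₀ λ (u , wu , a) → s₁ λ (v , wv , b) → dir w u v wu wv λ (t , wt , refines) →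
      k (t , wt , □-intro F V t d (var 0 ∧' var 1) λ s ts →
        Sat-stable F {V} {s} (var 0 ∧' var 1) λ n → refines s ts λ (us , vs) →
          n (∧-intro F V s (var 0) (var 1) (□-elim F V u d (var 0) a s us) (□-elim F V v d (var 1) b s vs)))

  valid⇒Directed : (F : Frame D) → Valid F directed → Directed F
  valid⇒Directed F valid w u v wu wv k =
    valid V w
      (λ n → n (u , wu , □-intro F V u d (var 0) λ s us m → m us))
      (λ n → n (v , wv , □-intro F V v d (var 1) λ s vs m → m vs))
      λ (t , wt , a) → k (t , wt , λ s ts n →
        let p , q = ∧-elim F V s (var 0) (var 1) (□-elim F V t d (var 0 ∧' var 1) a s ts) in
        p λ us → q λ vs → n (us , vs))
    where
    -- The least valuation making `□ d (var 0)` true at `u` and `□ d (var 1)` true at `v`.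
    V : ℕ → W F → Set
    V zero = R F d u
    V (suc _) = R F d v

module _ {A B : Set} (F : Frame A) (G : Frame B) (b : B) where

  Directed-⊗ : Directed b G → Directed (inj₂ b) (F ⊗ G)
  Directed-⊗ dir (x , y) (_ , u) (_ , v) (refl , yu) (refl , yv) k =
    dir y u v yu yv λ (t , yt , refines) → k ((x , t) , (refl , yt) ,
      λ { (_ , s) (refl , ts) n → refines s ts λ (us , vs) → n ((refl , us) , (refl , vs)) })

  -- The column over `x` is a copy of `G` closed under vertical steps, so the property can be read
  -- off there.
  Directed-⊗⁻ : W F → Directed (inj₂ b) (F ⊗ G) → Directed b G
  Directed-⊗⁻ x dir y u v yu yv k =
    dir (x , y) (x , u) (x , v) (refl , yu) (refl , yv)
      λ { ((_ , t) , (refl , yt) , refines) → k (t , yt , λ s ts n →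
        refines (x , s) (refl , ts) λ ((_ , us) , (_ , vs)) → n (us , vs)) }

-- Induction on the number of points to avoid. If the successor `z` found so far sees the next
-- point, `avoid` supplies a successor `z'` that does not, and a common refinement of `z` and `z'`
-- avoids whatever either of them avoids.
finite-escape : {B : Set} (G : Frame B) (b : B) → Directed b G → (g z₀ : W G) → R G b g z₀ →
  (∀ z y → R G b g z → R G b z y → ¬ ¬ Σ (W G) λ z' → R G b g z' × ¬ R G b z' y) →
  ∀ n (f : Fin n → W G) → ¬ ¬ Σ (W G) λ z → R G b g z × ∀ i → ¬ R G b z (f i)
finite-escape G b dir g z₀ gz₀ avoid zero f k = k (z₀ , gz₀ , λ ())
finite-escape G b dir g z₀ gz₀ avoid (suc n) f k =
  finite-escape G b dir g z₀ gz₀ avoid n (f ∘ suc) λ (z , gz , z-avoids) →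
    ¬¬-excluded-middle λ
      { (no n) → k (z , gz , λ { zero → n ; (suc i) → z-avoids i })
      ; (yes zf) → avoid z (f zero) gz zf λ (z' , gz' , z'-avoids) →
          dir g z z' gz gz' λ (t , gt , refines) → k (t , gt , λ
            { zero tf → refines _ tf λ (_ , z'f) → z'-avoids z'f
            ; (suc i) tf → refines _ tf λ (zf , _) → z-avoids i zf }) }

-- The formula separating finite products from `F∞ ⊗ G∞`

private
  ◇₁ ◇₂ □₁ □₂ : Form (Fin 1 ⊎ Fin 1) → Form (Fin 1 ⊎ Fin 1)
  ◇₁ = ◇ (inj₁ zero)
  ◇₂ = ◇ (inj₂ zero)
  □₁ = □ (inj₁ zero)
  □₂ = □ (inj₂ zero)

-- Classically the negation of
-- ◇₂⊤ ∧ □₂◇₂⊤ ∧ □₂□₂◇₁p ∧ □₁◇₂□₂¬p.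
¬escape : Form (Fin 1 ⊎ Fin 1)
¬escape = ◇₂ ⊤' ⇒ □₂ (◇₂ ⊤') ⇒ □₂ (□₂ (◇₁ (var 0))) ⇒ □₁ (◇₂ (□₂ (¬' (var 0)))) ⇒ ⊥'

finite⇒¬escape : (F G : Frame (Fin 1)) → Finite (W G) → Directed (inj₂ zero) (F ⊗ G) →
  Valid (F ⊗ G) ¬escape
finite⇒¬escape F G (n , W↔Fin) dir V (r , g) s₁ s₂ s₃ s₄ =
  s₁ λ { ((_ , z₀) , (refl , gz₀) , _) →
    -- The points to avoid enumerate all of `G`, so the resulting `z` sees nothing, against `s₂`.
    finite-escape G zero (Directed-⊗⁻ F G zero r dir) g z₀ gz₀ avoid n (Inverse.from W↔Fin)
      λ (z , gz , z-avoids) →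
        □-elim (F ⊗ G) V (r , g) (inj₂ zero) (◇₂ ⊤') s₂ (r , z) (refl , gz)
          λ { ((_ , y) , (refl , zy) , _) → z-avoids (Inverse.to W↔Fin y)
            (subst (R G zero z) (sym (Inverse.strictlyInverseʳ W↔Fin y)) zy) } }
  where
  -- By `s₃` some `x` has `var 0` true at `(x , y)`. By `s₄` some `z'` has `var 0` false at
  -- everything `(x , z')` sees vertically, so `z'` does not see `y`.
  avoid : ∀ z y → R G zero g z → R G zero z y → ¬ ¬ Σ (W G) λ z' → R G zero g z' × ¬ R G zero z' y
  avoid z y gz zy k =
    □-elim (F ⊗ G) V (r , z) (inj₂ zero) (◇₁ (var 0))
      (□-elim (F ⊗ G) V (r , g) (inj₂ zero) (□₂ (◇₁ (var 0))) s₃ (r , z) (refl , gz))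
      (r , y) (refl , zy)
      λ { ((x , _) , (rx , refl) , p) →
        □-elim (F ⊗ G) V (r , g) (inj₁ zero) (◇₂ (□₂ (¬' (var 0)))) s₄ (x , g) (rx , refl)
          λ { ((_ , z') , (refl , gz') , q) → k (z' , gz' , λ z'y →
            □-elim (F ⊗ G) V (x , z') (inj₂ zero) (¬' (var 0)) q (x , y) (refl , z'y) p) } }

-- The frames `F∞` and `G∞`

data Point : Set where
  root : Point
  mid leaf : ℕ → Point

data _⟶_ : Point → Point → Set where
  root-mid : ∀ {n} → root ⟶ mid n
  mid-leaf : ∀ {n m} → n ≤ m → mid n ⟶ leaf m

data _⟶F_ : Maybe ℕ → Maybe ℕ → Set where
  root-leaf : ∀ {n} → nothing ⟶F just n

F∞ G∞ : Frame (Fin 1)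
F∞ = record { W = Maybe ℕ ; R = λ _ → _⟶F_ }
G∞ = record { W = Point ; R = λ _ → _⟶_ }

F∞-NoPath : ∀ w → NoPath F∞ 2 w
F∞-NoPath _ _ _ root-leaf _ _ ()

G∞-NoPath : ∀ w → NoPath G∞ 3 w
G∞-NoPath _ _ _ root-mid _ _ (mid-leaf _) _ _ ()
G∞-NoPath _ _ _ (mid-leaf _) _ _ ()

-- A larger index sees fewer leaves, so the maximum of two indices refines both; a leaf sees nothing
-- and refines vacuously.
G∞-Directed : Directed zero G∞
G∞-Directed _ (mid n) (mid n') root-mid root-mid k = k (mid (n ⊔ n') , root-mid , λ
  { _ (mid-leaf l) j → j (mid-leaf (≤-trans (m≤m⊔n n n') l) , mid-leaf (≤-trans (m≤n⊔m n n') l)) })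
G∞-Directed _ (leaf m) _ (mid-leaf l) _ k = k (leaf m , mid-leaf l , λ _ ())

-- Over `just n`, the leaves carrying `var 0` are exactly those that `mid n` misses, while each
-- `leaf m` carries it over `just (suc m)`. Hence all four premises hold at `(nothing , root)`.
F∞⊗G∞-escape : ¬ Valid (F∞ ⊗ G∞) ¬escape
F∞⊗G∞-escape valid = valid V (nothing , root)
  (λ k → k ((nothing , mid 0) , (refl , root-mid) , id))
  (□-intro P V (nothing , root) (inj₂ zero) (◇₂ ⊤') λ { _ (refl , root-mid {n}) k →
    k ((nothing , leaf n) , (refl , mid-leaf ≤-refl) , id) })
  (□-intro P V (nothing , root) (inj₂ zero) (□₂ (◇₁ (var 0))) λ { _ (refl , root-mid {n}) →
    □-intro P V (nothing , mid n) (inj₂ zero) (◇₁ (var 0)) λ { _ (refl , mid-leaf {m = m} _) k →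
      k ((just (suc m) , leaf m) , (root-leaf , refl) , λ j → j ≤-refl) } })
  (□-intro P V (nothing , root) (inj₁ zero) (◇₂ (□₂ (¬' (var 0)))) λ { _ (root-leaf {n} , refl) k →
    k ((just n , mid n) , (refl , root-mid) , □-intro P V (just n , mid n) (inj₂ zero) (¬' (var 0))
      λ { _ (refl , mid-leaf n≤m) p → p λ m<n → <⇒≱ m<n n≤m }) })
  where
  P : Frame (Fin 1 ⊎ Fin 1)
  P = F∞ ⊗ G∞
  V : ℕ → Maybe ℕ × Point → Set
  V _ (just n , leaf m) = m < n
  V _ _ = ⊤

-- The product logic

L∞ : Pred (Form (Fin 1 ⊎ Fin 1)) (lsuc 0ℓ)
L∞ = Valid F∞ ×L Valid G∞

L∞-locallyTabular : LocallyTabular L∞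
L∞-locallyTabular = NoPath⇒LocallyTabular {ds = inj₁ zero ∷ inj₂ zero ∷ []}
  -- The factors allow at most one and two steps, so product paths have at most three, and `4` is
  -- the strict bound.
  (λ { (inj₁ zero) → here refl ; (inj₂ zero) → there (here refl) }) 4 L∞
  λ φ s F G F⊨ G⊨ V (x , y) → s (F ⊗ G) V (x , y)
    (NoPath-⊗ F G 1 2 (⊨Valid⇒NoPath F∞ F 2 F∞-NoPath F⊨ x) (⊨Valid⇒NoPath G∞ G 3 G∞-NoPath G⊨ y))

L∞-directed : L∞ (directed (inj₂ zero))
L∞-directed F G _ G⊨ = Directed⇒valid (inj₂ zero) (F ⊗ G)
  (Directed-⊗ F G zero (valid⇒Directed zero G
    (G⊨ (directed zero) (Directed⇒valid zero G∞ G∞-Directed))))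

-- Each product from `𝒞` validates `L∞`, hence is vertically directed, and its second factor is
-- finite. So `¬escape` is valid throughout `𝒞` and would belong to `L∞`, yet `F∞ ⊗ G∞` refutes it.
L∞-¬productFMP : ¬ ProductFMP {Fin 1} {Fin 1} L∞
L∞-¬productFMP (𝒞 , finite , char) = F∞⊗G∞-escape
  (from (char ¬escape)
    (λ F G c → finite⇒¬escape F G (proj₂ (finite F G c))
      (valid⇒Directed (inj₂ zero) (F ⊗ G) (to (char (directed (inj₂ zero))) L∞-directed F G c)))
    F∞ G∞ (λ _ v → v) (λ _ v → v))

theorem5p5 : Σ ℕ λ m → Σ ℕ λ n →
    Σ (Pred (Form (Fin m)) (lsuc 0ℓ)) λ L₁ → Σ (Pred (Form (Fin n)) (lsuc 0ℓ)) λ L₂ →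
    NormalLogic L₁ × NormalLogic L₂ ×
    LocallyTabular (L₁ ×L L₂) × ¬ ProductFMP {Fin m} {Fin n} (L₁ ×L L₂)
theorem5p5 = 1 , 1 , Valid F∞ , Valid G∞ , Valid-normal Fin._≟_ F∞ , Valid-normal Fin._≟_ G∞ ,
  L∞-locallyTabular , L∞-¬productFMP
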